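{- Every finite tree $T$ is $3,2$-perfect.
   Context: All graphs are simple and undirected with nonempty vertex set. A shortest path in a graph $G$ is a path between some vertices $u,v$ (in the same component) whose length (number of edges) equals the graph distance between $u$ and $v$. A set $S\subseteq V(G)$ is $k,d$-independent in $G$ if every shortest path in $G$ of length at most $d$ contains fewer than $k$ vertices of $S$. The $k,d$-chromatic number $\chi^k_d(G)$ is the least positive integer $c$ such that some coloring $V(G)\to\{1,\dots,c\}$ has all color classes $k,d$-independent. A set $S\subseteq V(G)$ is a $k,d$-clique in $G$ if every $k$-element subset of $S$ is contained in some shortest path of $G$ of length at most $d$ (sets with fewer than $k$ elements are vacuously $k,d$-cliques); $\omega^k_d(G)$ is the supremum of the sizes of $k,d$-cliques in $G$. For $2\le k\le d+1$, $G$ is $k,d$-perfect if $\chi^k_d(H)=\left\lceil\frac{\omega^k_d(H)}{k-1}\right\rceil$ for every induced subgraph $H$ of $G$ (shortest paths being computed in $H$). Here $k=3$ and $d=2$. -}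

module Defs where

open import Data.Fin using (Fin; _≟_)
open import Data.Fin.Subset using (Subset; _⊆_; _∩_; ∣_∣; ⁅_⁆; ⋃)
open import Data.Integer using (+_)
open import Data.List using (List; []; _∷_; map)
open import Data.List.Relation.Unary.Unique.Propositional using (Unique)
open import Data.Nat using (ℕ; suc; _∸_; _≤_; _<_; NonZero)
open import Data.Product using (_×_; ∃-syntax; Σ-syntax)
open import Data.Rational using (ceiling; _/_)
open import Data.Vec using (tabulate)
open import Function.Bundles using (_⇔_)
open import Function.Definitions using (Injective)
open import Level using (0ℓ)
open import Relation.Binary using (Rel; Symmetric; Irreflexive; Decidable)
open import Relation.Binary.PropositionalEquality using (_≡_)
open import Relation.Nullary using (¬_)
open import Relation.Nullary.Decidable using (⌊_⌋)

-- Finite simple graphs with nonempty vertex set Fin n.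
record Graph (n : ℕ) : Set₁ where
  field
    nonEmpty : NonZero n
    Adj      : Rel (Fin n) 0ℓ
    adj?     : Decidable Adj
    symm     : Symmetric Adj
    irrefl   : Irreflexive _≡_ Adj

open Graph public

module _ {n : ℕ} (G : Graph n) where

  data Walk : Fin n → Fin n → Set where
    [_] : (u : Fin n) → Walk u u
    _∷_ : {u v w : Fin n} → Adj G u v → Walk v w → Walk u w

module _ {n : ℕ} {G : Graph n} where

  length : {u v : Fin n} → Walk G u v → ℕ
  length [ u ]   = 0
  length (e ∷ p) = suc (length p)

  vertices : {u v : Fin n} → Walk G u v → List (Fin n)
  vertices [ u ]               = u ∷ []
  vertices (_∷_ {u = u} e p) = u ∷ vertices p

  vertexSet : {u v : Fin n} → Walk G u v → Subset n
  vertexSet p = ⋃ (map ⁅_⁆ (vertices p))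

  IsPath : {u v : Fin n} → Walk G u v → Set
  IsPath p = Unique (vertices p)

module _ {n : ℕ} (G : Graph n) where

  IsDistance : Fin n → Fin n → ℕ → Set
  IsDistance u v ℓ =
    (Σ[ p ∈ Walk G u v ] IsPath p × length p ≡ ℓ) ×
    ((p : Walk G u v) → IsPath p → ℓ ≤ length p)

  IsShortestPath : {u v : Fin n} → Walk G u v → Set
  IsShortestPath {u} {v} p = IsPath p × IsDistance u v (length p)

  Independent : (k d : ℕ) → Subset n → Set
  Independent k d S =
    {u v : Fin n} (p : Walk G u v) → IsShortestPath p → length p ≤ d →
    ∣ S ∩ vertexSet p ∣ < k

  Clique : (k d : ℕ) → Subset n → Set
  Clique k d S =
    (X : Subset n) → X ⊆ S → ∣ X ∣ ≡ k →
    ∃[ u ] ∃[ v ] Σ[ p ∈ Walk G u v ]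
      IsShortestPath p × length p ≤ d × X ⊆ vertexSet p

  colorClass : {c : ℕ} → (Fin n → Fin c) → Fin c → Subset n
  colorClass f i = tabulate λ v → ⌊ f v ≟ i ⌋

  Colorable : (k d c : ℕ) → Set
  Colorable k d c =
    Σ[ f ∈ (Fin n → Fin c) ] ((i : Fin c) → Independent k d (colorClass f i))

  IsChromaticNumber : (k d χ : ℕ) → Set
  IsChromaticNumber k d χ =
    (1 ≤ χ × Colorable k d χ) ×
    ((c : ℕ) → 1 ≤ c → Colorable k d c → χ ≤ c)

  -- The supremum is over finitely many sets, hence a maximum.
  IsCliqueNumber : (k d ω : ℕ) → Set
  IsCliqueNumber k d ω =
    (Σ[ S ∈ Subset n ] Clique k d S × ∣ S ∣ ≡ ω) ×
    ((S : Subset n) → Clique k d S → ∣ S ∣ ≤ ω)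

  Connected : Set
  Connected = (u v : Fin n) → Σ[ p ∈ Walk G u v ] IsPath p

  -- A cycle is a path of length at least 2 together with an edge joining
  -- its endpoints.
  Acyclic : Set
  Acyclic =
    {u v : Fin n} (p : Walk G u v) → IsPath p → 2 ≤ length p → ¬ Adj G v u

  IsTree : Set
  IsTree = Connected × Acyclic

-- H is an induced subgraph of G, its m vertices being relabelled by Fin m:
-- f is the inclusion of the vertex set.
record InducedSubgraph {m n : ℕ} (H : Graph m) (G : Graph n) : Set where
  field
    f         : Fin m → Fin n
    injective : Injective _≡_ _≡_ f
    adj⇔      : (u v : Fin m) → Adj H u v ⇔ Adj G (f u) (f v)

-- The instance argument expresses 2 ≤ k.  Perfection is meant for
-- 2 ≤ k ≤ d + 1 only; the upper bound is not needed to state it.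
-- χ and ω are asserted to exist, so the equality is never vacuous.
Perfect : (k d : ℕ) .{{_ : NonZero (k ∸ 1)}} {n : ℕ} → Graph n → Set₁
Perfect k d G =
  {m : ℕ} (H : Graph m) → InducedSubgraph H G →
  ∃[ χ ] ∃[ ω ] IsChromaticNumber H k d χ × IsCliqueNumber H k d ω ×
    + χ ≡ ceiling (+ ω / (k ∸ 1))

{-# OPTIONS --safe #-}
-- Erasing loops from a walk in an acyclic graph only removes backtracking, hence
-- preserves the parity of its length.  So closed walks are even, and a tree has
-- a proper 2-colouring by the parity of the distance to a root.
-- An induced subgraph H inherits this colouring and contains no 4-cycle.
-- If H has no path on three vertices, then χ = 1 and ω = min(2, |H|).
-- Otherwise χ = 2, and ω = 3: among four points of a clique, one triple is a
-- path a – b – c, and since a and c are not adjacent, the triple a, c, d must be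
-- the path a – d – c, which closes a 4-cycle.
module Submission where

open import Defs
open import Data.Empty using (⊥; ⊥-elim)
open import Data.Fin using (Fin; zero; suc; _≟_)
open import Data.Fin.Properties using (any?; suc-injective)
open import Data.Fin.Subset using (Subset; inside; outside; _∈_; _∉_; _⊆_; _∪_; _∩_; ∣_∣; ⁅_⁆; ⋃; ⊤)
open import Data.Fin.Subset.Properties
  using ( ∣⁅x⁆∣≡1; ∣⊥∣≡0; ∉⊥; x∈⁅x⁆; x∈⁅y⁆⇒x≡y; x∈p∪q⁺; x∈p∪q⁻; q⊆p∪q; x∈p∩q⁺; x∈p∩q⁻; p∩q⊆q; ∣p∩q∣≤∣q∣
        ; p⊆q⇒∣p∣≤∣q∣; p⊂q⇒∣p∣<∣q∣; ∣p∣≤n)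
open import Data.List as List using (List; []; _∷_)
open import Data.List.Membership.Propositional using () renaming (_∈_ to _∈ˡ_; _∉_ to _∉ˡ_)
open import Data.List.Properties using (length-map)
open import Data.List.Relation.Binary.Subset.Propositional using () renaming (_⊆_ to _⊆ˡ_)
open import Data.List.Relation.Unary.All as All using (All; []; _∷_)
import Data.List.Relation.Unary.All.Properties as Allₚ
open import Data.List.Relation.Unary.AllPairs using ([]; _∷_)
open import Data.List.Relation.Unary.Any using (here; there)
open import Data.List.Relation.Unary.Unique.Propositional using (Unique)
open import Data.List.Relation.Unary.Unique.Propositional.Properties using (map⁺; Unique[x∷xs]⇒x∉xs)
open import Data.Nat using (ℕ; zero; suc; _+_; _≤_; _<_; z≤n; s≤s; s≤s⁻¹; parity; _<?_)
open import Data.Nat.Properties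
  using ( ≤-refl; ≤-trans; ≤-reflexive; ≤-antisym; <-irrefl; <-≤-trans; ≤-<-trans; ≮⇒≥; +-suc; +-monoʳ-≤; n≤1+n
        ; module ≤-Reasoning)
open import Data.Parity as ℙ using (Parity; 0ℙ; 1ℙ)
open import Data.Parity.Properties using (suc-homo-⁻¹; ⁻¹-injective; +-homo-+; p+p≡0ℙ)
open import Data.Product using (_×_; _,_; proj₁; proj₂; Σ-syntax; ∃-syntax)
open import Data.Sum using (_⊎_; inj₁; inj₂)
open import Data.Vec using ([]; _∷_; here; there)
open import Data.Vec.Properties using (lookup∘tabulate; []=⇒lookup; lookup⇒[]=)
open import Function using (_∘_)
open import Function.Bundles using (Equivalence)
open import Relation.Binary.PropositionalEquality
  using (_≡_; _≢_; refl; sym; trans; cong; module ≡-Reasoning)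
open import Relation.Nullary using (¬_; Dec; yes; no; contradiction)
open import Relation.Nullary.Decidable using (isYes≗does; _×-dec_; ¬?; dec-true)

module _ {n : ℕ} where
  open import Data.List.Membership.DecPropositional (_≟_ {n}) public
    using () renaming (_∈?_ to _∈ˡ?_)

-- Finite subsets given by lists

∣p∪q∣≤∣p∣+∣q∣ : ∀ {n} (p q : Subset n) → ∣ p ∪ q ∣ ≤ ∣ p ∣ + ∣ q ∣
∣p∪q∣≤∣p∣+∣q∣ []            []            = z≤n
∣p∪q∣≤∣p∣+∣q∣ (outside ∷ p) (outside ∷ q) = ∣p∪q∣≤∣p∣+∣q∣ p q
∣p∪q∣≤∣p∣+∣q∣ (outside ∷ p) (inside  ∷ q) =
  ≤-trans (s≤s (∣p∪q∣≤∣p∣+∣q∣ p q)) (≤-reflexive (sym (+-suc ∣ p ∣ ∣ q ∣)))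
∣p∪q∣≤∣p∣+∣q∣ (inside  ∷ p) (outside ∷ q) = s≤s (∣p∪q∣≤∣p∣+∣q∣ p q)
∣p∪q∣≤∣p∣+∣q∣ (inside  ∷ p) (inside  ∷ q) =
  s≤s (≤-trans (∣p∪q∣≤∣p∣+∣q∣ p q) (+-monoʳ-≤ ∣ p ∣ (n≤1+n ∣ q ∣)))

fromList : ∀ {n} → List (Fin n) → Subset n
fromList xs = ⋃ (List.map ⁅_⁆ xs)

module _ {n : ℕ} where

  ∈-fromList⁺ : {x : Fin n} {xs : List (Fin n)} → x ∈ˡ xs → x ∈ fromList xs
  ∈-fromList⁺ (here refl) = x∈p∪q⁺ (inj₁ (x∈⁅x⁆ _))
  ∈-fromList⁺ (there x∈)  = x∈p∪q⁺ (inj₂ (∈-fromList⁺ x∈))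

  ∈-fromList⁻ : {x : Fin n} (xs : List (Fin n)) → x ∈ fromList xs → x ∈ˡ xs
  ∈-fromList⁻ []       x∈ = contradiction x∈ ∉⊥
  ∈-fromList⁻ (y ∷ xs) x∈ with x∈p∪q⁻ ⁅ y ⁆ (fromList xs) x∈
  ... | inj₁ x∈y  = here (x∈⁅y⁆⇒x≡y y x∈y)
  ... | inj₂ x∈xs = there (∈-fromList⁻ xs x∈xs)

  fromList-⊆ : {xs : List (Fin n)} {S : Subset n} → All (_∈ S) xs → fromList xs ⊆ S
  fromList-⊆ {xs} xs∈S x∈ = All.lookup xs∈S (∈-fromList⁻ xs x∈)

  ∣fromList∣≤length : (xs : List (Fin n)) → ∣ fromList xs ∣ ≤ List.length xs
  ∣fromList∣≤length []       = ≤-reflexive (∣⊥∣≡0 n)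
  ∣fromList∣≤length (x ∷ xs) = begin
    ∣ ⁅ x ⁆ ∪ fromList xs ∣       ≤⟨ ∣p∪q∣≤∣p∣+∣q∣ ⁅ x ⁆ (fromList xs) ⟩
    ∣ ⁅ x ⁆ ∣ + ∣ fromList xs ∣   ≡⟨ cong (_+ ∣ fromList xs ∣) (∣⁅x⁆∣≡1 x) ⟩
    suc ∣ fromList xs ∣           ≤⟨ s≤s (∣fromList∣≤length xs) ⟩
    suc (List.length xs)          ∎
    where open ≤-Reasoning

  -- Uniqueness makes each head a new element, so adding it strictly enlarges the set.
  length≤∣fromList∣ : {xs : List (Fin n)} → Unique xs → List.length xs ≤ ∣ fromList xs ∣
  length≤∣fromList∣ []                     = z≤n
  length≤∣fromList∣ {x ∷ xs} u@(_ ∷ uxs) =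
    ≤-<-trans (length≤∣fromList∣ uxs)
      (p⊂q⇒∣p∣<∣q∣ ( q⊆p∪q ⁅ x ⁆ (fromList xs)
                   , x , ∈-fromList⁺ {xs = x ∷ xs} (here refl)
                   , Unique[x∷xs]⇒x∉xs u ∘ ∈-fromList⁻ xs))

  ∣fromList∣≡length : {xs : List (Fin n)} → Unique xs → ∣ fromList xs ∣ ≡ List.length xs
  ∣fromList∣≡length {xs} u = ≤-antisym (∣fromList∣≤length xs) (length≤∣fromList∣ u)

distinctElements : ∀ {n} k (S : Subset n) → k ≤ ∣ S ∣ →
  Σ[ xs ∈ List (Fin n) ] Unique xs × All (_∈ S) xs × List.length xs ≡ k
distinctElements zero    S             _     = [] , [] , [] , refl
distinctElements (suc k) (outside ∷ S) k≤∣S∣ with distinctElements (suc k) S k≤∣S∣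
... | xs , u , xs∈S , eq =
  List.map suc xs , map⁺ suc-injective u , Allₚ.map⁺ (All.map there xs∈S) ,
  trans (length-map suc xs) eq
distinctElements (suc k) (inside ∷ S) k≤∣S∣ with distinctElements k S (s≤s⁻¹ k≤∣S∣)
... | xs , u , xs∈S , eq =
  zero ∷ List.map suc xs ,
  Allₚ.map⁺ (All.universal (λ _ ()) xs) ∷ map⁺ suc-injective u ,
  here ∷ Allₚ.map⁺ (All.map there xs∈S) ,
  cong suc (trans (length-map suc xs) eq)

-- Walks

module _ {n : ℕ} {G : Graph n} where

  length-vertices : {u v : Fin n} (p : Walk G u v) → List.length (vertices p) ≡ suc (length p)
  length-vertices [ u ]   = refl
  length-vertices (e ∷ p) = cong suc (length-vertices p)

  ∣vertexSet∣≤ : {u v : Fin n} (p : Walk G u v) → ∣ vertexSet p ∣ ≤ suc (length p)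
  ∣vertexSet∣≤ p = ≤-trans (∣fromList∣≤length (vertices p)) (≤-reflexive (length-vertices p))

  source∈vertices : {u v : Fin n} (p : Walk G u v) → u ∈ˡ vertices p
  source∈vertices [ u ]   = here refl
  source∈vertices (e ∷ p) = here refl

  target∈vertices : {u v : Fin n} (p : Walk G u v) → v ∈ˡ vertices p
  target∈vertices [ u ]   = here refl
  target∈vertices (e ∷ p) = there (target∈vertices p)

  ∷-isPath : {u v w : Fin n} (e : Adj G u v) (p : Walk G v w) →
    u ∉ˡ vertices p → IsPath p → IsPath (e ∷ p)
  ∷-isPath e p u∉p pathp = Allₚ.¬Any⇒All¬ (vertices p) u∉p ∷ pathp

  -- The inclusion of `q` in `p` is carried along because it keeps the first vertex off the initial
  -- segment, which therefore remains a path.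
  splitPath : {u v w : Fin n} (p : Walk G v w) → IsPath p → u ∈ˡ vertices p →
    Σ[ q ∈ Walk G v u ] Σ[ r ∈ Walk G u w ]
      IsPath q × IsPath r × vertices q ⊆ˡ vertices p × length q + length r ≡ length p
  splitPath [ v ]   pathp       (here refl) = [ v ] , [ v ] , pathp , pathp , (λ x∈ → x∈) , refl
  splitPath (e ∷ p) pathp       (here refl) =
    [ _ ] , e ∷ p , [] ∷ [] , pathp , (λ { (here refl) → here refl }) , refl
  splitPath (e ∷ p) (v∉ ∷ path) (there u∈)  with splitPath p path u∈
  ... | q , r , pathq , pathr , q⊆p , eq =
    e ∷ q , r , Allₚ.anti-mono q⊆p v∉ ∷ pathq , pathr ,
    (λ { (here eq) → here eq ; (there x∈) → there (q⊆p x∈) }) , cong suc eq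

  -- Reversal with an accumulator: the walk runs `p` backwards from `v` to `u` and continues along
  -- `q`.
  reverseOnto : {u v w : Fin n} → Walk G u v → Walk G u w → Walk G v w
  reverseOnto [ u ]   q = q
  reverseOnto (e ∷ p) q = reverseOnto p (symm G e ∷ q)

  length-reverseOnto : {u v w : Fin n} (p : Walk G u v) (q : Walk G u w) →
    length (reverseOnto p q) ≡ length p + length q
  length-reverseOnto [ u ]   q = refl
  length-reverseOnto (e ∷ p) q =
    trans (length-reverseOnto p (symm G e ∷ q)) (+-suc (length p) (length q))

-- Loop erasure and parity in acyclic graphs

parity-suc : ∀ m n → parity m ≡ parity n → parity (suc m) ≡ parity (suc n)
parity-suc m n eq = ⁻¹-injective (trans (suc-homo-⁻¹ m) (trans eq (sym (suc-homo-⁻¹ n))))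

module _ {n : ℕ} {G : Graph n} (acyclic : Acyclic G) where

  -- Induction on the walk: prepend the edge `e` to the erased tail `q`. If `u` already lies on `q`,
  -- the segment of `q` up to `u` together with `e` would be a cycle unless it is one edge; then the
  -- walk backtracks, and both edges are dropped.
  eraseLoops : {u v : Fin n} (p : Walk G u v) →
    Σ[ q ∈ Walk G u v ] IsPath q × parity (length p) ≡ parity (length q)
  eraseLoops [ u ] = [ u ] , [] ∷ [] , refl
  eraseLoops (_∷_ {u = u} e p) with eraseLoops p
  ... | q , pathq , p≡q with u ∈ˡ? vertices q
  ...   | no u∉q  = e ∷ q , ∷-isPath e q u∉q pathq , parity-suc (length p) (length q) p≡q
  ...   | yes u∈q with splitPath q pathq u∈q
  ...     | [ _ ] , _ , _ = ⊥-elim (irrefl G refl e)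
  -- Here `q` is one edge longer than `s`, so restoring `e` gives two edges more than `s`, and
  -- `parity` computes past two successors.
  ...     | _ ∷ [ _ ] , s , _ , paths , _ , eq =
    s , paths , parity-suc (length p) (suc (length s)) (trans p≡q (cong parity (sym eq)))
  ...     | r@(_ ∷ _ ∷ _) , _ , pathr , _ = ⊥-elim (acyclic r pathr (s≤s (s≤s z≤n)) e)

  -- Loop erasure leaves a path from `u` to itself, which can only be the trivial one.
  closedWalk-even : {u : Fin n} (p : Walk G u u) → parity (length p) ≡ 0ℙ
  closedWalk-even p with eraseLoops p
  ... | [ _ ] , _     , p≡q = p≡q
  ... | e ∷ q , pathq , _   = contradiction (target∈vertices q) (Unique[x∷xs]⇒x∉xs pathq)

-- Proper 2-colourings and 4-cycles

ProperColouring : ∀ {n} → Graph n → (Fin n → Fin 2) → Set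
ProperColouring G col = ∀ {u v} → Adj G u v → col u ≢ col v

-- Neighbouring corners differ by irreflexivity, so distinctness is asked of the two diagonals only.
SquareFree : ∀ {n} → Graph n → Set
SquareFree G = ∀ {a b c d} → Adj G a b → Adj G b c → Adj G c d → Adj G d a → a ≢ c → b ≢ d → ⊥

toFin : Parity → Fin 2
toFin 0ℙ = zero
toFin 1ℙ = suc zero

toFin-injective : ∀ {p q} → toFin p ≡ toFin q → p ≡ q
toFin-injective {0ℙ} {0ℙ} _ = refl
toFin-injective {1ℙ} {1ℙ} _ = refl

Fin2-alternate : {x y z : Fin 2} → x ≢ y → y ≢ z → x ≡ z
Fin2-alternate {zero}     {zero}     x≢y _   = contradiction refl x≢y
Fin2-alternate {zero}     {suc zero} {zero}     _ _ = refl
Fin2-alternate {zero}     {suc zero} {suc zero} _ y≢z = contradiction refl y≢z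
Fin2-alternate {suc zero} {suc zero} x≢y _   = contradiction refl x≢y
Fin2-alternate {suc zero} {zero}     {suc zero} _ _ = refl
Fin2-alternate {suc zero} {zero}     {zero}     _ y≢z = contradiction refl y≢z

adj⇒≢ : ∀ {n} (G : Graph n) {u v} → Adj G u v → u ≢ v
adj⇒≢ G e u≡v = irrefl G u≡v e

module _ {n : ℕ} {T : Graph n} where

  -- Were the ends of an edge of equal colour, the edge and the two paths to the root would form a
  -- closed walk of odd length.
  tree-properColouring : IsTree T → Fin n → Σ[ col ∈ (Fin n → Fin 2) ] ProperColouring T col
  tree-properColouring (connected , acyclic) root = toFin ∘ parity ∘ depth , proper
    where
    depth : Fin n → ℕ
    depth v = length (proj₁ (connected root v))

    proper : ProperColouring T (toFin ∘ parity ∘ depth)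
    proper {u} {v} e same = contradiction (trans (sym odd) even) λ ()
      where
      open ≡-Reasoning
      loop : Walk T v u
      -- From `v` back to the root, then out to `u`; the edge `e` closes it.
      loop = reverseOnto (proj₁ (connected root v)) (proj₁ (connected root u))

      even : parity (suc (length loop)) ≡ 0ℙ
      even = closedWalk-even acyclic (e ∷ loop)

      odd : parity (suc (length loop)) ≡ 1ℙ
      odd = parity-suc (length loop) 0 (begin
        parity (length loop)                       ≡⟨ cong parity (length-reverseOnto (proj₁ (connected root v)) _) ⟩
        parity (depth v + depth u)                 ≡⟨ +-homo-+ (depth v) (depth u) ⟩
        parity (depth v) ℙ.+ parity (depth u)
          ≡⟨ cong (parity (depth v) ℙ.+_) (toFin-injective same) ⟩
        parity (depth v) ℙ.+ parity (depth v) ≡⟨ p+p≡0ℙ (parity (depth v)) ⟩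
        0ℙ                                         ∎)

  -- Three sides of the square form a path, and the fourth joins its ends.
  acyclic-squareFree : Acyclic T → SquareFree T
  acyclic-squareFree acyclic {a} {b} {c} {d} ab bc cd da a≢c b≢d =
    acyclic (ab ∷ bc ∷ cd ∷ [ d ])
      ( (adj⇒≢ T ab ∷ a≢c ∷ adj⇒≢ T da ∘ sym ∷ [])
      ∷ (adj⇒≢ T bc ∷ b≢d ∷ [])
      ∷ (adj⇒≢ T cd ∷ [])
      ∷ [] ∷ [])
      (s≤s (s≤s z≤n)) da

  module _ {m : ℕ} {H : Graph m} (H⊆T : InducedSubgraph H T) where
    open InducedSubgraph H⊆T

    map-adj : ∀ {u v} → Adj H u v → Adj T (f u) (f v)
    map-adj = Equivalence.to (adj⇔ _ _)

    induced-properColouring : ∀ {col} → ProperColouring T col → ProperColouring H (col ∘ f)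
    induced-properColouring proper e = proper (map-adj e)

    induced-squareFree : SquareFree T → SquareFree H
    induced-squareFree squareFree ab bc cd da a≢c b≢d =
      squareFree (map-adj ab) (map-adj bc) (map-adj cd) (map-adj da)
        (a≢c ∘ injective) (b≢d ∘ injective)

-- Colour classes, cliques, and graphs without a path on three vertices

module _ {m : ℕ} {H : Graph m} where

  ∈-colorClass⁺ : ∀ {c} (col : Fin m → Fin c) {i v} → col v ≡ i → v ∈ colorClass H col i
  ∈-colorClass⁺ col {i} {v} eq =
    lookup⇒[]= v _ (trans (lookup∘tabulate _ v) (trans (isYes≗does (col v ≟ i)) (dec-true (col v ≟ i) eq)))

  ∈-colorClass⁻ : ∀ {c} (col : Fin m → Fin c) {i v} → v ∈ colorClass H col i → col v ≡ i
  ∈-colorClass⁻ col {i} {v} v∈ with col v ≟ i | trans (sym (lookup∘tabulate _ v)) ([]=⇒lookup v∈)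
  ... | yes eq | _ = eq
  ... | no _   | ()

  -- There is no `k`-element subset to be covered.
  trivialClique : ∀ {k d} (S : Subset m) → ∣ S ∣ < k → Clique H k d S
  trivialClique S ∣S∣<k X X⊆S refl = contradiction (<-≤-trans ∣S∣<k (p⊆q⇒∣p∣≤∣q∣ X⊆S)) (<-irrefl refl)

  -- The ends `u` and `w` may be adjacent here; a proper 2-colouring will exclude that and make the
  -- path a shortest one.
  HasP₃ : Set
  HasP₃ = ∃[ u ] ∃[ v ] ∃[ w ] Adj H u v × Adj H v w × u ≢ w

  hasP₃? : Dec HasP₃
  hasP₃? = any? λ u → any? λ v → any? λ w → adj? H u v ×-dec adj? H v w ×-dec ¬? (u ≟ w)

  module _ (noP₃ : ¬ HasP₃) where

    -- The first two edges of a longer path have distinct outer ends, which gives `HasP₃`.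
    path-length≤1 : ∀ {u v} (p : Walk H u v) → IsPath p → length p ≤ 1
    path-length≤1 [ _ ]       _ = z≤n
    path-length≤1 (_ ∷ [ _ ]) _ = ≤-refl
    path-length≤1 (e ∷ e′ ∷ p) ((_ ∷ u≢) ∷ _) =
      contradiction (_ , _ , _ , e , e′ , All.lookup u≢ (source∈vertices p)) noP₃

    path-∣vertexSet∣≤2 : ∀ {u v} (p : Walk H u v) → IsPath p → ∣ vertexSet p ∣ ≤ 2
    path-∣vertexSet∣≤2 p pathp = ≤-trans (∣vertexSet∣≤ p) (s≤s (path-length≤1 p pathp))

    chromaticNumber≡1 : IsChromaticNumber H 3 2 1
    chromaticNumber≡1 =
      ( ≤-refl
      , (λ _ → zero)
      , λ i p (pathp , _) _ →
          s≤s (≤-trans (∣p∩q∣≤∣q∣ (colorClass H (λ _ → zero) i) (vertexSet p)) (path-∣vertexSet∣≤2 p pathp)))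
      , λ _ 1≤c _ → 1≤c

    clique-size≤2 : ∀ {S} → Clique H 3 2 S → ∣ S ∣ ≤ 2
    clique-size≤2 {S} clique with 2 <? ∣ S ∣
    ... | no ≮   = ≮⇒≥ ≮
    ... | yes 3≤ with distinctElements 3 S 3≤
    ...   | xs , u , xs∈S , len with clique (fromList xs) (fromList-⊆ xs∈S) (trans (∣fromList∣≡length u) len)
    ...     | _ , _ , p , (pathp , _) , _ , xs⊆p =
      contradiction
        (≤-trans (≤-reflexive (sym (trans (∣fromList∣≡length u) len)))
          (≤-trans (p⊆q⇒∣p∣≤∣q∣ xs⊆p) (path-∣vertexSet∣≤2 p pathp)))
        λ { (s≤s (s≤s ())) }

  -- Properly 2-coloured graphs and paths on three vertices

  Triple : Fin m → Fin m → Fin m → Set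
  Triple x y z = Adj H x y × Adj H y z

  module _ {u v w} (uv : Adj H u v) (vw : Adj H v w) (u≢w : u ≢ w) where

    P₃ : Walk H u w
    P₃ = uv ∷ vw ∷ [ w ]

    P₃-isPath : IsPath P₃
    P₃-isPath = (adj⇒≢ H uv ∷ u≢w ∷ []) ∷ (adj⇒≢ H vw ∷ []) ∷ [] ∷ []

    ∣P₃∣≡3 : ∣ vertexSet P₃ ∣ ≡ 3
    ∣P₃∣≡3 = ∣fromList∣≡length P₃-isPath

  module _ {col : Fin m → Fin 2} (proper : ProperColouring H col) where

    triangleFree : ∀ {u v w} → Adj H u v → Adj H v w → ¬ Adj H u w
    triangleFree uv vw uw = proper uw (Fin2-alternate (proper uv) (proper vw))

    -- A path of length at most 2 has at most three vertices, and no colour class contains both ends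
    -- of its first edge.
    2-colorable : Colorable H 3 2 2
    2-colorable = col , independent
      where
      independent : ∀ i → Independent H 3 2 (colorClass H col i)
      independent i [ u ] _ _ =
        s≤s (≤-trans (∣p∩q∣≤∣q∣ (colorClass H col i) (vertexSet {G = H} [ u ]))
          (≤-trans (∣vertexSet∣≤ {G = H} [ u ]) (s≤s z≤n)))
      independent i p@(_∷_ {u = u} {v = v} e q) _ len =
        <-≤-trans (p⊂q⇒∣p∣<∣q∣ (p∩q⊆q (colorClass H col i) (vertexSet p) , missing))
          (≤-trans (∣vertexSet∣≤ p) (s≤s len))
        where
        missing : ∃[ x ] x ∈ vertexSet p × x ∉ colorClass H col i ∩ vertexSet p
        missing with col u ≟ i
        ... | no u≢i  = u , ∈-fromList⁺ {xs = vertices p} (here refl) ,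
          u≢i ∘ ∈-colorClass⁻ col ∘ proj₁ ∘ x∈p∩q⁻ _ (vertexSet p)
        ... | yes u≡i = v , ∈-fromList⁺ {xs = vertices p} (there (source∈vertices q)) ,
          λ v∈ → proper e (trans u≡i (sym (∈-colorClass⁻ col (proj₁ (x∈p∩q⁻ _ (vertexSet p) v∈)))))

    module _ {u v w} (uv : Adj H u v) (vw : Adj H v w) (u≢w : u ≢ w) where

      private
        path : Walk H u w
        path = P₃ uv vw u≢w

        pathp : IsPath path
        pathp = P₃-isPath uv vw u≢w

      -- A shorter path would be a single edge `uw`, closing a triangle.
      P₃-isShortestPath : IsShortestPath H path
      P₃-isShortestPath = pathp , (path , pathp , refl) , shortest
        where
        shortest : (p : Walk H u w) → IsPath p → 2 ≤ length p
        shortest [ _ ]        _ = contradiction refl u≢w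
        shortest (uw ∷ [ _ ]) _ = ⊥-elim (triangleFree uv vw uw)
        shortest (_ ∷ _ ∷ _)  _ = s≤s (s≤s z≤n)

      P₃-clique : Clique H 3 2 (vertexSet path)
      P₃-clique X X⊆path _ = u , w , path , P₃-isShortestPath , ≤-refl , X⊆path

      -- A single colour class would contain all three vertices of a shortest path of length 2.
      2≤colours : ∀ c → 1 ≤ c → Colorable H 3 2 c → 2 ≤ c
      2≤colours 1 _ (g , independent) = contradiction
        (≤-<-trans
          (p⊆q⇒∣p∣≤∣q∣ λ x∈ → x∈p∩q⁺ (∈-colorClass⁺ g (only-colour (g _)) , x∈))
          (independent zero path P₃-isShortestPath ≤-refl))
        (<-irrefl (∣P₃∣≡3 uv vw u≢w))
        where
        only-colour : (i : Fin 1) → i ≡ zero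
        only-colour zero = refl
      2≤colours (suc (suc c)) _ _ = s≤s (s≤s z≤n)

      chromaticNumber≡2 : IsChromaticNumber H 3 2 2
      chromaticNumber≡2 = (s≤s z≤n , 2-colorable) , 2≤colours

    -- A path of length at most 2 through three points has exactly these vertices. The alternatives
    -- say which of `x`, `y`, `z` is its centre.
    clique-triple : ∀ {S x y z} → Clique H 3 2 S → All (_∈ S) (x ∷ y ∷ z ∷ []) →
      Unique (x ∷ y ∷ z ∷ []) → Triple y x z ⊎ Triple x y z ⊎ Triple x z y
    clique-triple {S} {x} {y} {z} clique xs∈S unique@((x≢y ∷ x≢z ∷ []) ∷ (y≢z ∷ []) ∷ [] ∷ [])
      with clique (fromList (x ∷ y ∷ z ∷ [])) (fromList-⊆ xs∈S) (∣fromList∣≡length unique)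
    ... | _ , _ , p , (_ , _) , len≤2 , xs⊆p = go p len≤2 xs⊆p
      where
      X : Subset m
      X = fromList (x ∷ y ∷ z ∷ [])

      ∣X∣≤ : ∀ {u w} (p : Walk H u w) → X ⊆ vertexSet p → 3 ≤ suc (length p)
      ∣X∣≤ p X⊆p = ≤-trans (length≤∣fromList∣ unique) (≤-trans (p⊆q⇒∣p∣≤∣q∣ X⊆p) (∣vertexSet∣≤ p))

      go : ∀ {u w} (p : Walk H u w) → length p ≤ 2 → X ⊆ vertexSet p →
        Triple y x z ⊎ Triple x y z ⊎ Triple x z y
      go p@([ _ ])     _ X⊆p = contradiction (∣X∣≤ p X⊆p) λ { (s≤s ()) }
      go p@(_ ∷ [ _ ]) _ X⊆p = contradiction (∣X∣≤ p X⊆p) λ { (s≤s (s≤s ())) }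
      go (_ ∷ _ ∷ _ ∷ _) (s≤s (s≤s ())) _
      go p@(_∷_ {u} {v} uv (vw ∷ [ w ])) _ X⊆p = result
        where
        -- A point of the triple other than the centre `v` is an end of the path.
        neighbour : ∀ {t} → t ∈ˡ x ∷ y ∷ z ∷ [] → t ≢ v → Adj H v t
        neighbour t∈ t≢v with ∈-fromList⁻ (vertices p) (X⊆p (∈-fromList⁺ t∈))
        ... | here refl                 = symm H uv
        ... | there (here refl)         = contradiction refl t≢v
        ... | there (there (here refl)) = vw

        -- Both X and the path have three vertices, so the middle one lies in X.
        v∈X : v ∈ˡ x ∷ y ∷ z ∷ []
        v∈X with v ∈ˡ? (x ∷ y ∷ z ∷ [])
        ... | yes v∈ = v∈
        ... | no v∉ = contradiction
          (≤-<-trans (length≤∣fromList∣ unique)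
            (<-≤-trans
              (p⊂q⇒∣p∣<∣q∣ (X⊆p , v , ∈-fromList⁺ {xs = vertices p} (there (here refl)) , v∉ ∘ ∈-fromList⁻ _))
              (∣vertexSet∣≤ p)))
          (<-irrefl refl)

        result : Triple y x z ⊎ Triple x y z ⊎ Triple x z y
        result with v∈X
        ... | here refl = inj₁
          (symm H (neighbour (there (here refl)) (x≢y ∘ sym)) , neighbour (there (there (here refl))) (x≢z ∘ sym))
        ... | there (here refl) = inj₂ (inj₁
          (symm H (neighbour (here refl) x≢y) , neighbour (there (there (here refl))) (y≢z ∘ sym)))
        ... | there (there (here refl)) = inj₂ (inj₂
          (symm H (neighbour (here refl) x≢z) , neighbour (there (here refl)) y≢z))

    module _ (squareFree : SquareFree H) where

      -- In the triple `a`, `c`, `d` neither `a` nor `c` can be the centre, since `a` and `c` would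
      -- be adjacent and form a triangle with `b`. With `d` as centre, `a`, `b`, `c`, `d` is a
      -- 4-cycle.
      noFourthPoint : ∀ {S a b c d} → Clique H 3 2 S → All (_∈ S) (a ∷ c ∷ d ∷ []) →
        Unique (a ∷ c ∷ d ∷ []) → b ≢ d → ¬ Triple a b c
      noFourthPoint clique ∈S unique@((a≢c ∷ _) ∷ _) b≢d (ab , bc)
        with clique-triple clique ∈S unique
      ... | inj₁ (ca , _)         = triangleFree ab bc (symm H ca)
      ... | inj₂ (inj₁ (ac , _))  = triangleFree ab bc ac
      ... | inj₂ (inj₂ (ad , dc)) = squareFree ab bc (symm H dc) (symm H ad) a≢c b≢d

      clique-size≤3 : ∀ {S} → Clique H 3 2 S → ∣ S ∣ ≤ 3
      clique-size≤3 {S} clique with 3 <? ∣ S ∣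
      ... | no ≮   = ≮⇒≥ ≮
      ... | yes 4≤ with distinctElements 4 S 4≤
      ...   | a ∷ b ∷ c ∷ d ∷ [] , (a≢b ∷ a≢c ∷ a≢d ∷ []) ∷ (b≢c ∷ b≢d ∷ []) ∷ (c≢d ∷ []) ∷ [] ∷ []
            , a∈ ∷ b∈ ∷ c∈ ∷ d∈ ∷ [] , refl
            with clique-triple clique (a∈ ∷ b∈ ∷ c∈ ∷ []) ((a≢b ∷ a≢c ∷ []) ∷ (b≢c ∷ []) ∷ [] ∷ [])
      -- In each case the centre of the first triple plays the role of `b` in `noFourthPoint`, and
      -- its two ends are paired with `d`.
      ...     | inj₁ bac = ⊥-elim
        (noFourthPoint clique (b∈ ∷ c∈ ∷ d∈ ∷ []) ((b≢c ∷ b≢d ∷ []) ∷ (c≢d ∷ []) ∷ [] ∷ []) a≢d bac)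
      ...     | inj₂ (inj₁ abc) = ⊥-elim
        (noFourthPoint clique (a∈ ∷ c∈ ∷ d∈ ∷ []) ((a≢c ∷ a≢d ∷ []) ∷ (c≢d ∷ []) ∷ [] ∷ []) b≢d abc)
      ...     | inj₂ (inj₂ acb) = ⊥-elim
        (noFourthPoint clique (a∈ ∷ b∈ ∷ d∈ ∷ []) ((a≢b ∷ a≢d ∷ []) ∷ (b≢d ∷ []) ∷ [] ∷ []) c≢d acb)

      cliqueNumber≡3 : ∀ {u v w} → Adj H u v → Adj H v w → u ≢ w → IsCliqueNumber H 3 2 3
      cliqueNumber≡3 uv vw u≢w =
        (vertexSet (P₃ uv vw u≢w) , P₃-clique uv vw u≢w , ∣P₃∣≡3 uv vw u≢w) , λ _ → clique-size≤3

-- Clique numbers without a path on three vertices, and perfection of trees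

-- Sets of at most two vertices are cliques vacuously, so the value depends only on whether there is
-- a second vertex.
cliqueNumber-noP₃ : ∀ {m} {H : Graph (suc m)} → ¬ HasP₃ {H = H} →
  IsCliqueNumber H 3 2 1 ⊎ IsCliqueNumber H 3 2 2
cliqueNumber-noP₃ {zero} noP₃ =
  inj₁ ((⊤ , trivialClique ⊤ (s≤s (s≤s z≤n)) , refl) , λ S _ → ∣p∣≤n S)
cliqueNumber-noP₃ {suc m} {H} noP₃ =
  inj₂ ((fromList pair , trivialClique (fromList pair) (s≤s (≤-reflexive ∣pair∣≡2)) , ∣pair∣≡2)
       , λ S → clique-size≤2 noP₃)
  where
  pair : List (Fin (suc (suc m)))
  pair = zero ∷ suc zero ∷ []

  ∣pair∣≡2 : ∣ fromList pair ∣ ≡ 2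
  ∣pair∣≡2 = ∣fromList∣≡length {xs = pair} (((λ ()) ∷ []) ∷ [] ∷ [])

graph-vertex : ∀ {n} → Graph n → Fin n
graph-vertex {zero}  G with nonEmpty G
... | ()
graph-vertex {suc n} G = zero

proposition3p6 : {n : ℕ} (T : Graph n) → IsTree T → Perfect 3 2 T
proposition3p6 T tree {zero}  H H⊆T = contradiction (graph-vertex H) λ ()
proposition3p6 T tree@(_ , acyclic) {suc m} H H⊆T with hasP₃? {H = H}
... | yes (u , v , w , uv , vw , u≢w) =
  -- The closing `refl` evaluates the ceiling of 3/2 to 2.
  2 , 3 , chromaticNumber≡2 proper uv vw u≢w ,
  cliqueNumber≡3 proper squareFree uv vw u≢w , refl
  where
  proper = induced-properColouring H⊆T (proj₂ (tree-properColouring tree (graph-vertex T)))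
  squareFree = induced-squareFree H⊆T (acyclic-squareFree acyclic)
... | no noP₃ with cliqueNumber-noP₃ noP₃
-- Both 1/2 and 2/2 have ceiling 1, so either clique number agrees with χ = 1.
...   | inj₁ ω≡1 = 1 , 1 , chromaticNumber≡1 noP₃ , ω≡1 , refl
...   | inj₂ ω≡2 = 1 , 2 , chromaticNumber≡1 noP₃ , ω≡2 , refl
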